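{- There exists a finite outerplanar graph $G$ such that the vertices of $G$ cannot be non-repetitively coloured using fewer than five colours; that is, every non-repetitive vertex colouring of $G$ uses at least five colours.
   Context: A finite sequence $a_1a_2\cdots a_n$ is called non-repetitive if it contains no two identical adjacent blocks, i.e. there are no $i$ and $m\ge 1$ with $i+2m-1\le n$ and $a_{i+j}=a_{i+m+j}$ for all $0\le j<m$. A vertex colouring of a graph $G$ is called non-repetitive if for every path $v_1v_2\cdots v_n$ in $G$ with distinct vertices, the sequence of colours of $v_1,\dots,v_n$ is non-repetitive. A graph is outerplanar if it has a planar embedding in which all vertices lie on the boundary of the outer face. -}

module Defs where

open import Level using (0ℓ)
open import Data.Nat.Base using (ℕ)
open import Data.Fin.Base using (Fin) renaming (_<_ to _<ᶠ_)
open import Data.Rational.Base using (ℚ; 0ℚ; 1ℚ; _+_; _*_; _-_; _≤_; _<_; ∣_∣)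
open import Data.List.Base using (List; []; _∷_; _++_; map; length; tabulate; deduplicate)
open import Data.List.Relation.Unary.Linked using (Linked)
open import Data.List.Relation.Unary.Unique.Propositional using (Unique)
open import Data.Product.Base using (∃; ∃-syntax; _×_; _,_; proj₁; proj₂)
open import Data.Sum.Base using (_⊎_)
open import Function.Definitions using (Injective)
open import Relation.Binary.Core using (Rel)
open import Relation.Binary.Definitions using (Symmetric; Irreflexive; Decidable; DecidableEquality)
open import Relation.Binary.PropositionalEquality.Core using (_≡_; _≢_)
open import Relation.Nullary.Negation.Core using (¬_)
open import Relation.Unary using (Pred; ∁)

record Graph : Set₁ where
  field
    order   : ℕ
  Vertex : Set
  Vertex = Fin order
  field
    Adj     : Rel Vertex 0ℓ
    adj?    : Decidable Adj
    symm    : Symmetric Adj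
    irrefl  : Irreflexive _≡_ Adj

  IsPath : List Vertex → Set
  IsPath vs = Linked Adj vs × Unique vs

open Graph public using (Vertex)

Repetitive : {A : Set} → List A → Set
Repetitive as = ∃[ xs ] ∃[ ys ] ∃[ zs ] (ys ≢ [] × as ≡ xs ++ ys ++ ys ++ zs)

NonRepetitive : {A : Set} → List A → Set
NonRepetitive as = ¬ Repetitive as

NonRepetitiveColouring : (G : Graph) {C : Set} → (Vertex G → C) → Set
NonRepetitiveColouring G c = ∀ vs → Graph.IsPath G vs → NonRepetitive (map c vs)

coloursUsed : {n : ℕ} {C : Set} → DecidableEquality C → (Fin n → C) → ℕ
coloursUsed _≟_ c = length (deduplicate _≟_ (tabulate c))

-- Embeddings are polygonal with rational coordinates.  This is no loss for
-- finite graphs, and rational points suffice to test incidences: if two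
-- segments with rational endpoints meet in ℝ², they meet in a rational point.

Point : Set
Point = ℚ × ℚ

Region : Set₁
Region = Pred Point 0ℓ

Segment : Point → Point → Region
Segment (a₁ , a₂) (b₁ , b₂) p =
  ∃[ t ] (0ℚ ≤ t × t ≤ 1ℚ ×
          p ≡ ((1ℚ - t) * a₁ + t * b₁ , (1ℚ - t) * a₂ + t * b₂))

-- The middle argument of Polyline and Simple lists the intermediate corners.

Polyline : Point → List Point → Point → Region
Polyline a []       b p = Segment a b p
Polyline a (c ∷ cs) b p = Segment a c p ⊎ Polyline c cs b p

Simple : Point → List Point → Point → Set
Simple a []       b = a ≢ b
Simple a (c ∷ cs) b =
  a ≢ c × (∀ p → Segment a c p → Polyline c cs b p → p ≡ c) × Simple c cs b

record PlanarEmbedding (G : Graph) : Set where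
  open Graph G using (Adj)

  -- Each undirected edge is represented once, by its increasing pair of ends.
  Edge : Vertex G → Vertex G → Set
  Edge u v = u <ᶠ v × Adj u v

  field
    pos   : Vertex G → Point
    bends : Vertex G → Vertex G → List Point

  Arc : Vertex G → Vertex G → Region
  Arc u v = Polyline (pos u) (bends u v) (pos v)

  field
    pos-injective : Injective _≡_ _≡_ pos
    arc-simple    : ∀ {u v} → Edge u v → Simple (pos u) (bends u v) (pos v)
    arc-vertex    : ∀ {u v} → Edge u v → ∀ w → Arc u v (pos w) → w ≡ u ⊎ w ≡ v
    -- Together with arc-vertex: distinct edges meet only at a common end.
    arc-arc       : ∀ {u v x y} → Edge u v → Edge x y → (u , v) ≢ (x , y) →
                    ∀ p → Arc u v p → Arc x y p → ∃[ w ] p ≡ pos w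

  Drawing : Region
  Drawing p = (∃[ w ] p ≡ pos w) ⊎ (∃[ u ] ∃[ v ] (Edge u v × Arc u v p))

-- Connectedness by polygonal paths, which for open sets is connectedness.
Component : Region → Point → Region
Component S p q = ∃[ cs ] (∀ r → Polyline p cs q r → S r)

Unbounded : Region → Set
Unbounded S = ∀ B → ∃[ q ] (S q × (B < ∣ proj₁ q ∣ ⊎ B < ∣ proj₂ q ∣))

Near : ℚ → Point → Region
Near ε (p₁ , p₂) (q₁ , q₂) = ∣ p₁ - q₁ ∣ < ε × ∣ p₂ - q₂ ∣ < ε

Boundary : Region → Region
Boundary S p = ∀ ε → 0ℚ < ε →
  (∃[ q ] (Near ε p q × S q)) × (∃[ q ] (Near ε p q × ¬ S q))

-- A drawing is bounded, so exactly one component of its complement is unbounded.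
OuterFace : {G : Graph} → PlanarEmbedding G → Region
OuterFace e p = Unbounded (Component (∁ (PlanarEmbedding.Drawing e)) p)

Outerplanar : Graph → Set
Outerplanar G =
  ∃[ e ] (∀ v → Boundary (OuterFace {G} e) (PlanarEmbedding.pos e v))

{-# OPTIONS --safe #-}

-- Chords of the parabola y = x² drawn between its rational points cross only if
-- their abscissae interlace, and each vertex can be reached from below; hence a
-- graph whose vertices are linearly ordered without crossing edges is outerplanar.
--
-- With at most four colours, a fan over a path on four vertices uses all of
-- them: the path avoids the colour of the apex and contains three colours, two
-- colours admitting no non-repetitive word of length four.  If x is the apex of
-- such a fan and x, y, z is a path avoiding it, then x and z have different colours,
-- since otherwise a fan vertex p of the colour of y gives the square p x y z.
-- A fan over a path x₁ ⋯ x₆, with further fans at x₃ and x₄, is thus not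
-- 4-colourable: three consecutive xᵢ have three different colours, so the colours
-- on the path are periodic with period 3 and form a square.
module Submission where

open import Defs
open import Data.Empty using (⊥)
open import Data.Nat.Base as ℕ using (ℕ; zero; suc; _≤_; s≤s)
import Data.Nat.Properties as ℕ
open import Data.Fin.Base as Fin using (Fin; zero; suc) renaming (_<_ to _<ᶠ_)
open import Data.Fin using (#_)
import Data.Fin.Properties as Fin
open import Data.List.Base using (List; []; _∷_; _++_; map; length; lookup; tabulate; zip; drop)
open import Data.List.Properties using (map-++; ++-identityʳ)
open import Data.List.Membership.Propositional using (_∈_)
open import Data.List.Membership.Propositional.Properties
  using (∈-lookup; ∈-tabulate⁺; ∈-deduplicate⁺; ∈-map⁻)
import Data.List.Membership.DecPropositional as DecMembership
import Data.List.Membership.Setoid.Properties as Membershipₛ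
open import Data.List.Relation.Binary.Subset.Propositional using (_⊆_)
open import Data.List.Relation.Unary.All as All using (All; []; _∷_; all?)
import Data.List.Relation.Unary.All.Properties as All
open import Data.List.Relation.Unary.AllPairs using ([]; _∷_)
open import Data.List.Relation.Unary.Any as Any using (here; there)
import Data.List.Relation.Unary.Any.Properties as Any
open import Data.List.Relation.Unary.Linked using ([-]; _∷_; linked?)
open import Data.List.Relation.Unary.Unique.Propositional using (Unique)
import Data.List.Relation.Unary.Unique.DecPropositional as DecUnique
open import Data.Product.Base using (∃-syntax; _×_; _,_; proj₁; proj₂)
open import Data.Product.Properties using (≡-dec)
open import Data.Rational.Base as ℚ
  using (ℚ; 0ℚ; 1ℚ; _+_; _*_; _-_; -_; _⊓_; ∣_∣; positive; nonNegative)
import Data.Rational.Properties as ℚ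
open import Data.Rational.Solver using (module +-*-Solver)
open import Data.Sum.Base as Sum using (_⊎_; inj₁; inj₂)
open import Function.Base using (_∘_)
open import Relation.Binary.Definitions using (DecidableEquality; tri<; tri≈; tri>)
open import Relation.Binary.PropositionalEquality
open import Relation.Nullary
open import Relation.Nullary.Decidable
  using (from-yes; map′; _×-dec_; _⊎-dec_; ¬?; decidable-stable)
open import Relation.Unary using (Decidable)

-- Counting colours

module _ {A : Set} where

  lookup-injective : ∀ {xs : List A} → Unique xs →
                     ∀ {i j} → lookup xs i ≡ lookup xs j → i ≡ j
  lookup-injective (x∉xs ∷ xs!) {zero}  {zero}  eq = refl
  lookup-injective (x∉xs ∷ xs!) {zero}  {suc j} eq =
    contradiction eq (All.lookup x∉xs (∈-lookup j))
  lookup-injective (x∉xs ∷ xs!) {suc i} {zero}  eq =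
    contradiction (sym eq) (All.lookup x∉xs (∈-lookup i))
  lookup-injective (x∉xs ∷ xs!) {suc i} {suc j} eq = cong suc (lookup-injective xs! eq)

  -- Pigeonhole: sending a position in `xs` to the position where its entry is found in `ys` is
  -- injective.
  unique-⊆⇒length-≤ : ∀ {xs ys : List A} → Unique xs → xs ⊆ ys → length xs ≤ length ys
  unique-⊆⇒length-≤ xs! xs⊆ys = Fin.injective⇒≤ λ {i} {j} eq →
    lookup-injective xs!
      (Membershipₛ.index-injective (setoid A) (xs⊆ys (∈-lookup i)) (xs⊆ys (∈-lookup j)) eq)

unique⇒≤coloursUsed : ∀ {n} {C : Set} (_≟_ : DecidableEquality C) (c : Fin n → C) vs →
                      Unique (map c vs) → length (map c vs) ≤ coloursUsed _≟_ c
unique⇒≤coloursUsed _≟_ c vs cvs! = unique-⊆⇒length-≤ cvs! λ x∈ →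
  let w , _ , eq = ∈-map⁻ c x∈
  in subst (_∈ _) (sym eq) (∈-deduplicate⁺ _≟_ (∈-tabulate⁺ w))

-- Non-repetitive colourings of fans

module _ (G : Graph) where
  open Graph G hiding (Vertex)

  record Fan (v : Vertex G) (ws : List (Vertex G)) : Set where
    constructor fan
    field
      spokes : All (Adj v) ws
      rim    : IsPath ws

  path? : Decidable IsPath
  path? vs = linked? adj? vs ×-dec DecUnique.unique? Fin._≟_ vs

  fan? : ∀ v ws → Dec (Fan v ws)
  fan? v ws = map′ (λ (spokes , rim) → fan spokes rim) (λ (fan spokes rim) → spokes , rim)
    (all? (adj? v) ws ×-dec path? ws)

  path₂ : ∀ {u v} → Adj u v → IsPath (u ∷ v ∷ [])
  path₂ uv = uv ∷ [-] , ((λ u≡v → irrefl u≡v uv) ∷ []) ∷ [] ∷ []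

  module _ {C : Set} {c : Vertex G → C} (nonrep : NonRepetitiveColouring G c) where

    -- The case of empty outer parts in `Repetitive`: every square used below fills its whole path.
    no-square : ∀ us {vs} → us ≢ [] → IsPath (us ++ vs) → map c us ≢ map c vs
    no-square []       us≢[] path eq = us≢[] refl
    no-square (u ∷ us) {vs} us≢[] path eq = nonrep _ path
      ([] , map c (u ∷ us) , [] , (λ ()) , (begin
        map c (u ∷ us ++ vs)                  ≡⟨ map-++ c (u ∷ us) vs ⟩
        map c (u ∷ us) ++ map c vs            ≡⟨ cong (map c (u ∷ us) ++_) eq ⟨
        map c (u ∷ us) ++ map c (u ∷ us)      ≡⟨ cong (map c (u ∷ us) ++_) (++-identityʳ _) ⟨
        map c (u ∷ us) ++ map c (u ∷ us) ++ [] ∎))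
      where open ≡-Reasoning

    adjacent-≢ : ∀ {u v} → Adj u v → c u ≢ c v
    adjacent-≢ uv eq = no-square (_ ∷ []) (λ ()) (path₂ uv) (cong (_∷ []) eq)

    module _ (_≟_ : DecidableEquality C) (few : coloursUsed _≟_ c ≤ 4) where

      -- A colour missing from the list would extend it to five distinct colours.
      four-exhaust : ∀ {vs} → 4 ≤ length (map c vs) → Unique (map c vs) →
                     ∀ w → c w ∈ map c vs
      four-exhaust {vs} 4≤∣vs∣ cvs! w = decidable-stable (c w ∈? map c vs) λ cw∉ →
        ℕ.<⇒≱ (s≤s 4≤∣vs∣) (ℕ.≤-trans
          (unique⇒≤coloursUsed _≟_ c (w ∷ vs) (All.¬Any⇒All¬ _ cw∉ ∷ cvs!)) few)
        where open DecMembership _≟_ using (_∈?_)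

      -- If `p` and `r` differ in colour, then `v`, `p`, `q`, `r` carry four colours. Otherwise `q`
      -- and `s` differ, lest the rim be a square, and `v`, `q`, `r`, `s` carry four colours.
      fan-exhausts : ∀ {v p q r s} → Fan v (p ∷ q ∷ r ∷ s ∷ []) → ∀ w → c w ≢ c v →
                     c w ∈ map c (p ∷ q ∷ r ∷ s ∷ [])
      fan-exhausts {v} {p} {q} {r} {s}
        (fan (vp ∷ vq ∷ vr ∷ vs ∷ []) path@(pq ∷ qr ∷ rs ∷ [-] , _)) w w≢v
        with c p ≟ c r
      ... | no p≢r = Any.tail w≢v
        (weaken (four-exhaust {v ∷ p ∷ q ∷ r ∷ []} ℕ.≤-refl
          ( (adjacent-≢ vp ∷ adjacent-≢ vq ∷ adjacent-≢ vr ∷ [])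
          ∷ (adjacent-≢ pq ∷ p≢r ∷ [])
          ∷ (adjacent-≢ qr ∷ [])
          ∷ [] ∷ []) w))
        where
        weaken : c w ∈ map c (v ∷ p ∷ q ∷ r ∷ []) → c w ∈ map c (v ∷ p ∷ q ∷ r ∷ s ∷ [])
        weaken = Any.++⁺ˡ
      ... | yes p≡r = there (Any.tail w≢v
        (four-exhaust {v ∷ q ∷ r ∷ s ∷ []} ℕ.≤-refl
          ( (adjacent-≢ vq ∷ adjacent-≢ vr ∷ adjacent-≢ vs ∷ [])
          ∷ (adjacent-≢ qr ∷ q≢s ∷ [])
          ∷ (adjacent-≢ rs ∷ [])
          ∷ [] ∷ []) w))
        where
        q≢s : c q ≢ c s
        q≢s q≡s = no-square (p ∷ q ∷ []) (λ ()) path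
          (cong₂ (λ a b → a ∷ b ∷ []) p≡r q≡s)

      -- A path from every rim vertex is required, since the colouring decides which of them shares
      -- the colour of `y`.
      fan-apex-≢ : ∀ {x y z p q r s} → Fan x (p ∷ q ∷ r ∷ s ∷ []) → Adj x y →
                   All (λ w → IsPath (w ∷ x ∷ y ∷ z ∷ [])) (p ∷ q ∷ r ∷ s ∷ []) →
                   c x ≢ c z
      fan-apex-≢ {x} {y} {z} f xy paths x≡z
        with w , w∈ , y≡w ← ∈-map⁻ c (fan-exhausts f y (adjacent-≢ xy ∘ sym))
        = no-square (w ∷ x ∷ []) (λ ()) (All.lookup paths w∈)
            (cong₂ (λ a b → a ∷ b ∷ []) (sym y≡w) x≡z)

      -- The vertices `v`, `x`, `y`, `z` carry four colours, so `w` repeats one of them; adjacency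
      -- rules out `v` and `z`, and the last hypothesis rules out `y`.
      period-3 : ∀ {v x y z w} → Fan v (x ∷ y ∷ z ∷ w ∷ []) → c x ≢ c z → c y ≢ c w →
                 c x ≡ c w
      period-3 {v} {x} {y} {z} {w}
        (fan (vx ∷ vy ∷ vz ∷ vw ∷ []) (xy ∷ yz ∷ zw ∷ [-] , _)) x≢z y≢w
        with four-exhaust {v ∷ x ∷ y ∷ z ∷ []} ℕ.≤-refl
          ( (adjacent-≢ vx ∷ adjacent-≢ vy ∷ adjacent-≢ vz ∷ [])
          ∷ (adjacent-≢ xy ∷ x≢z ∷ [])
          ∷ (adjacent-≢ yz ∷ [])
          ∷ [] ∷ []) w
      ... | here w≡v                         = contradiction (sym w≡v) (adjacent-≢ vw)
      ... | there (here w≡x)                 = sym w≡x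
      ... | there (there (here w≡y))         = contradiction (sym w≡y) y≢w
      ... | there (there (there (here w≡z))) = contradiction (sym w≡z) (adjacent-≢ zw)

-- Outerplanarity of graphs without crossing edges

p≤q⇒0≤q-p : ∀ {p q} → p ℚ.≤ q → 0ℚ ℚ.≤ q - p
p≤q⇒0≤q-p {p} {q} p≤q = subst (ℚ._≤ q - p) (ℚ.+-inverseʳ p) (ℚ.+-monoˡ-≤ (- p) p≤q)

p<q⇒0<q-p : ∀ {p q} → p ℚ.< q → 0ℚ ℚ.< q - p
p<q⇒0<q-p {p} {q} p<q = subst (ℚ._< q - p) (ℚ.+-inverseʳ p) (ℚ.+-monoˡ-< (- p) p<q)

0≤q-p⇒p≤q : ∀ {p q} → 0ℚ ℚ.≤ q - p → p ℚ.≤ q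
0≤q-p⇒p≤q {p} {q} 0≤q-p = subst₂ ℚ._≤_ (ℚ.+-identityˡ p)
  (solve 2 (λ p q → (q :- p) :+ p := q) refl p q) (ℚ.+-monoˡ-≤ p 0≤q-p)
  where open +-*-Solver

*-nonNeg : ∀ {p q} → 0ℚ ℚ.≤ p → 0ℚ ℚ.≤ q → 0ℚ ℚ.≤ p * q
*-nonNeg {p} {q} 0≤p 0≤q = ℚ.nonNegative⁻¹ (p * q)
  {{ℚ.nonNeg*nonNeg⇒nonNeg p {{nonNegative 0≤p}} q {{nonNegative 0≤q}}}}

*-pos : ∀ {p q} → 0ℚ ℚ.< p → 0ℚ ℚ.< q → 0ℚ ℚ.< p * q
*-pos {p} {q} 0<p 0<q = ℚ.positive⁻¹ (p * q)
  {{ℚ.pos*pos⇒pos p {{positive 0<p}} q {{positive 0<q}}}}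

p≤∣p∣ : ∀ p → p ℚ.≤ ∣ p ∣
p≤∣p∣ p with ℚ.≤-total 0ℚ p
... | inj₁ 0≤p = ℚ.≤-reflexive (sym (ℚ.0≤p⇒∣p∣≡p 0≤p))
... | inj₂ p≤0 = ℚ.≤-trans p≤0 (ℚ.0≤∣p∣ p)

-- Chords of the parabola

onParabola : ℚ → Point
onParabola x = x , x * x

-- The vertical distance at `x` from the parabola up to the chord, whose line is
-- `y = (a + b) * x - a * b`.
height : ℚ → ℚ → ℚ → ℚ
height a b x = (x - a) * (b - x)

-- Free of the segment parameter, so that chords are compared through their heights at a common
-- abscissa.
record OnChord (a b : ℚ) (p : Point) : Set where
  field
    lower : a ℚ.≤ proj₁ p
    upper : proj₁ p ℚ.≤ b
    above : proj₂ p ≡ proj₁ p * proj₁ p + height a b (proj₁ p)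

open OnChord

segment⇒onChord : ∀ {a b p} → a ℚ.≤ b → Segment (onParabola a) (onParabola b) p →
                  OnChord a b p
segment⇒onChord {a} {b} a≤b (t , 0≤t , t≤1 , refl) = record
  { lower = 0≤q-p⇒p≤q (subst (0ℚ ℚ.≤_)
      (solve 3 (λ a b t → t :* (b :- a) :=
        ((con 1ℚ :- t) :* a :+ t :* b) :- a) refl a b t)
      (*-nonNeg 0≤t 0≤b-a))
  ; upper = 0≤q-p⇒p≤q (subst (0ℚ ℚ.≤_)
      (solve 3 (λ a b t → (con 1ℚ :- t) :* (b :- a) :=
        b :- ((con 1ℚ :- t) :* a :+ t :* b)) refl a b t)
      (*-nonNeg (p≤q⇒0≤q-p t≤1) 0≤b-a))
  ; above = solve 3 (λ a b t → let x = (con 1ℚ :- t) :* a :+ t :* b in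
      (con 1ℚ :- t) :* (a :* a) :+ t :* (b :* b) := x :* x :+ (x :- a) :* (b :- x))
      refl a b t
  }
  where
  open +-*-Solver
  0≤b-a = p≤q⇒0≤q-p a≤b

segment-source : ∀ {a b} → Segment a b a
segment-source {a₁ , a₂} {b₁ , b₂} = 0ℚ , ℚ.≤-refl , from-yes (0ℚ ℚ.≤? 1ℚ) ,
  cong₂ _,_ (eq a₁ b₁) (eq a₂ b₂)
  where
  open +-*-Solver
  eq : ∀ a b → a ≡ (1ℚ - 0ℚ) * a + 0ℚ * b
  eq = solve 2 (λ a b → a := (con 1ℚ :- con 0ℚ) :* a :+ con 0ℚ :* b) refl

vertical-segment : ∀ {x y₀ y₁ r} → y₁ ℚ.≤ y₀ → Segment (x , y₀) (x , y₁) r →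
                   proj₁ r ≡ x × proj₂ r ℚ.≤ y₀
vertical-segment {x} {y₀} {y₁} y₁≤y₀ (t , 0≤t , t≤1 , refl) =
  solve 2 (λ x t → (con 1ℚ :- t) :* x :+ t :* x := x) refl x t ,
  0≤q-p⇒p≤q (subst (0ℚ ℚ.≤_)
    (solve 3 (λ y₀ y₁ t → t :* (y₀ :- y₁) := y₀ :- ((con 1ℚ :- t) :* y₀ :+ t :* y₁))
      refl y₀ y₁ t)
    (*-nonNeg 0≤t (p≤q⇒0≤q-p y₁≤y₀)))
  where open +-*-Solver

p≤p+q : ∀ p {q} → 0ℚ ℚ.≤ q → p ℚ.≤ p + q
p≤p+q p {q} 0≤q = subst (ℚ._≤ p + q) (ℚ.+-identityʳ p) (ℚ.+-monoʳ-≤ p 0≤q)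

p<p+q : ∀ p {q} → 0ℚ ℚ.< q → p ℚ.< p + q
p<p+q p {q} 0<q = subst (ℚ._< p + q) (ℚ.+-identityʳ p) (ℚ.+-monoʳ-< p 0<q)

onChord⇒above : ∀ {a b p} → OnChord a b p → proj₁ p * proj₁ p ℚ.≤ proj₂ p
onChord⇒above {p = x , _} on = subst (x * x ℚ.≤_) (sym (above on))
  (p≤p+q (x * x) (*-nonNeg (p≤q⇒0≤q-p (lower on)) (p≤q⇒0≤q-p (upper on))))

between : ∀ {a b x} → a ℚ.≤ x → x ℚ.≤ b → (a ℚ.< x × x ℚ.< b) ⊎ (x ≡ a ⊎ x ≡ b)
between {a} {b} {x} a≤x x≤b with ℚ.<-cmp a x | ℚ.<-cmp x b
... | tri≈ _ a≡x _ | _            = inj₂ (inj₁ (sym a≡x))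
... | _            | tri≈ _ x≡b _ = inj₂ (inj₂ x≡b)
... | tri< a<x _ _ | tri< x<b _ _ = inj₁ (a<x , x<b)
... | tri> _ _ x<a | _            = contradiction (ℚ.<-≤-trans x<a a≤x) (ℚ.<-irrefl refl)
... | _            | tri> _ _ b<x = contradiction (ℚ.<-≤-trans b<x x≤b) (ℚ.<-irrefl refl)

-- Strictly between the ends both factors of `height` are positive, so the chord runs strictly above
-- the parabola.
onParabola-onChord : ∀ {a b x} → OnChord a b (onParabola x) → x ≡ a ⊎ x ≡ b
onParabola-onChord {x = x} on with between (lower on) (upper on)
... | inj₂ end         = end
... | inj₁ (a<x , x<b) = contradiction (above on)
  (ℚ.<⇒≢ (p<p+q (x * x) (*-pos (p<q⇒0<q-p a<x) (p<q⇒0<q-p x<b))))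

-- Widening the interval decreases neither of the two positive factors and increases at least one.
-- One strict end suffices, so chords sharing an end are covered.
height-mono : ∀ {a b c d x} → a ℚ.≤ c → d ℚ.≤ b → a ℚ.< c ⊎ d ℚ.< b → c ℚ.< x → x ℚ.< d →
              height c d x ℚ.< height a b x
height-mono {a} {b} {c} {d} {x} a≤c d≤b proper c<x x<d = lemma proper
  where
  open ℚ.≤-Reasoning
  instance
    d-x-pos = positive (p<q⇒0<q-p x<d)
    b-x-pos = positive (p<q⇒0<q-p (ℚ.<-≤-trans x<d d≤b))
    x-c-pos = positive (p<q⇒0<q-p c<x)
    b-x-nonNeg = ℚ.pos⇒nonNeg (b - x)
    x-c-nonNeg = ℚ.pos⇒nonNeg (x - c)
  lemma : a ℚ.< c ⊎ d ℚ.< b → height c d x ℚ.< height a b x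
  lemma (inj₁ a<c) = begin-strict
    (x - c) * (d - x) ≤⟨ ℚ.*-monoˡ-≤-nonNeg (x - c) (ℚ.+-monoˡ-≤ (- x) d≤b) ⟩
    (x - c) * (b - x) <⟨ ℚ.*-monoˡ-<-pos (b - x) (ℚ.+-monoʳ-< x (ℚ.neg-antimono-< a<c)) ⟩
    (x - a) * (b - x) ∎
  lemma (inj₂ d<b) = begin-strict
    (x - c) * (d - x) <⟨ ℚ.*-monoʳ-<-pos (x - c) (ℚ.+-monoˡ-< (- x) d<b) ⟩
    (x - c) * (b - x) ≤⟨ ℚ.*-monoʳ-≤-nonNeg (b - x) (ℚ.+-monoʳ-≤ x (ℚ.neg-antimono-≤ a≤c)) ⟩
    (x - a) * (b - x) ∎

onParabola-end : ∀ {a b p} → OnChord a b p → proj₁ p ≡ a ⊎ proj₁ p ≡ b →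
                 p ≡ onParabola (proj₁ p)
onParabola-end {a} {b} {x , y} on end = cong (x ,_) (begin
  y                       ≡⟨ above on ⟩
  x * x + height a b x    ≡⟨ cong (x * x +_) (height≡0 end) ⟩
  x * x + 0ℚ              ≡⟨ ℚ.+-identityʳ (x * x) ⟩
  x * x                   ∎)
  where
  open ≡-Reasoning
  height≡0 : x ≡ a ⊎ x ≡ b → height a b x ≡ 0ℚ
  height≡0 (inj₁ refl) = trans (cong (_* (b - x)) (ℚ.+-inverseʳ x)) (ℚ.*-zeroˡ (b - x))
  height≡0 (inj₂ refl) = trans (cong ((x - a) *_) (ℚ.+-inverseʳ x)) (ℚ.*-zeroʳ (x - a))

-- Over the interior of the inner chord the outer one is strictly higher.
onChord-nested : ∀ {a b c d p} → a ℚ.≤ c → d ℚ.≤ b → a ℚ.< c ⊎ d ℚ.< b →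
                 OnChord a b p → OnChord c d p → proj₁ p ≡ c ⊎ proj₁ p ≡ d
onChord-nested {p = x , _} a≤c d≤b proper ab cd with between (lower cd) (upper cd)
... | inj₂ end         = end
... | inj₁ (c<x , x<d) = contradiction (trans (sym (above cd)) (above ab))
  (ℚ.<⇒≢ (ℚ.+-monoʳ-< (x * x) (height-mono a≤c d≤b proper c<x x<d)))

-- Vertices at integer abscissae

abscissa : ∀ {n} → Fin n → ℚ
abscissa zero    = 0ℚ
abscissa (suc i) = 1ℚ + abscissa i

abscissa-nonNeg : ∀ {n} (i : Fin n) → 0ℚ ℚ.≤ abscissa i
abscissa-nonNeg zero    = ℚ.≤-refl
abscissa-nonNeg (suc i) = ℚ.+-mono-≤ (from-yes (0ℚ ℚ.≤? 1ℚ)) (abscissa-nonNeg i)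

abscissa-mono-< : ∀ {n} {i j : Fin n} → i <ᶠ j → abscissa i ℚ.< abscissa j
abscissa-mono-< {i = zero}  {suc j} _   =
  ℚ.+-mono-<-≤ (from-yes (0ℚ ℚ.<? 1ℚ)) (abscissa-nonNeg j)
abscissa-mono-< {i = suc i} {suc j} i<j = ℚ.+-monoʳ-< 1ℚ (abscissa-mono-< (ℕ.s<s⁻¹ i<j))

abscissa-injective : ∀ {n} {i j : Fin n} → abscissa i ≡ abscissa j → i ≡ j
abscissa-injective {i = i} {j} eq with Fin.<-cmp i j
... | tri< i<j _ _ = contradiction eq (ℚ.<⇒≢ (abscissa-mono-< i<j))
... | tri≈ _ i≡j _ = i≡j
... | tri> _ _ j<i = contradiction (sym eq) (ℚ.<⇒≢ (abscissa-mono-< j<i))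

-- The straight-line drawing on the parabola

module _ (G : Graph)
  (noncrossing : ∀ {u v x y} → Graph.Adj G u v → Graph.Adj G x y →
                 u <ᶠ x → x <ᶠ v → ¬ v <ᶠ y)
  where
  open Graph G using (Adj)

  private
    pos : Vertex G → Point
    pos = onParabola ∘ abscissa

    Edge : Vertex G → Vertex G → Set
    Edge u v = u <ᶠ v × Adj u v

    Arc : Vertex G → Vertex G → Region
    Arc u v = Segment (pos u) (pos v)

    arc⇒onChord : ∀ {u v p} → Edge u v → Arc u v p → OnChord (abscissa u) (abscissa v) p
    arc⇒onChord (u<v , _) = segment⇒onChord (ℚ.<⇒≤ (abscissa-mono-< u<v))

    is-vertex : ∀ {u v p} → OnChord (abscissa u) (abscissa v) p →
                proj₁ p ≡ abscissa u ⊎ proj₁ p ≡ abscissa v → ∃[ w ] p ≡ pos w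
    is-vertex {u} {v} on end = Sum.[ (λ eq → u , trans p≡ (cong onParabola eq))
                                   , (λ eq → v , trans p≡ (cong onParabola eq)) ] end
      where p≡ = onParabola-end on end

    mono-≤ : ∀ {u v : Vertex G} → ¬ v <ᶠ u → abscissa u ℚ.≤ abscissa v
    mono-≤ {u} {v} v≮u with Fin.<-cmp u v
    ... | tri< u<v _ _  = ℚ.<⇒≤ (abscissa-mono-< u<v)
    ... | tri≈ _ refl _ = ℚ.≤-refl
    ... | tri> _ _ v<u  = contradiction v<u v≮u

    -- The negated inequalities place the interval of `x`, `y` inside that of `u`, `v`; as the edges
    -- differ, the inclusion is strict at one end.
    nested : ∀ {u v x y p} → Edge u v → Edge x y → (u , v) ≢ (x , y) →
             ¬ x <ᶠ u → ¬ v <ᶠ y → Arc u v p → Arc x y p → ∃[ w ] p ≡ pos w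
    nested {u} {v} {x} {y} uv xy uv≢xy x≮u v≮y p∈uv p∈xy =
      is-vertex {x} {y} onxy
        (onChord-nested (mono-≤ x≮u) (mono-≤ v≮y) proper (arc⇒onChord uv p∈uv) onxy)
      where
      onxy = arc⇒onChord xy p∈xy
      proper : abscissa u ℚ.< abscissa x ⊎ abscissa y ℚ.< abscissa v
      proper with Fin.<-cmp u x | Fin.<-cmp y v
      ... | tri< u<x _ _  | _             = inj₁ (abscissa-mono-< u<x)
      ... | tri> _ _ x<u  | _             = contradiction x<u x≮u
      ... | tri≈ _ _ _    | tri< y<v _ _  = inj₂ (abscissa-mono-< y<v)
      ... | tri≈ _ _ _    | tri> _ _ v<y  = contradiction v<y v≮y
      ... | tri≈ _ refl _ | tri≈ _ refl _ = contradiction refl uv≢xy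

    -- A common point lies neither right of `v` nor left of `x`, which forces its abscissa to be
    -- that of `v`.
    separated : ∀ {u v x y p} → Edge u v → Edge x y → ¬ x <ᶠ v →
                Arc u v p → Arc x y p → ∃[ w ] p ≡ pos w
    separated {u} {v} uv xy x≮v p∈uv p∈xy =
      is-vertex {u} {v} onuv (inj₂ (ℚ.≤-antisym (upper onuv)
        (ℚ.≤-trans (mono-≤ x≮v) (lower (arc⇒onChord xy p∈xy)))))
      where onuv = arc⇒onChord uv p∈uv

    arc-arc : ∀ {u v x y} → Edge u v → Edge x y → (u , v) ≢ (x , y) →
              ∀ p → Arc u v p → Arc x y p → ∃[ w ] p ≡ pos w
    arc-arc {u} {v} {x} {y} uv xy uv≢xy p p∈uv p∈xy
      -- Two intervals are separated, nested or interlacing, and `noncrossing` excludes the last.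
      with x Fin.<? v | u Fin.<? y | x Fin.<? u | y Fin.<? v | v Fin.<? y | u Fin.<? x
    ... | no x≮v  | _       | _       | _       | _       | _       =
      separated uv xy x≮v p∈uv p∈xy
    ... | _       | no u≮y  | _       | _       | _       | _       =
      separated xy uv u≮y p∈xy p∈uv
    ... | _       | yes u<y | yes x<u | yes y<v | _       | _       =
      contradiction y<v (noncrossing (proj₂ xy) (proj₂ uv) x<u u<y)
    ... | _       | _       | yes x<u | no y≮v  | _       | _       =
      nested xy uv (uv≢xy ∘ sym) (Fin.<-asym x<u) y≮v p∈xy p∈uv
    ... | _       | _       | no x≮u  | _       | no v≮y  | _       =
      nested uv xy uv≢xy x≮u v≮y p∈uv p∈xy
    ... | yes x<v | _       | no x≮u  | _       | yes v<y | yes u<x =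
      contradiction v<y (noncrossing (proj₂ uv) (proj₂ xy) u<x x<v)
    -- Here `u` and `x` coincide, and the arc from `u` to `v` is the inner one.
    ... | _       | _       | no x≮u  | _       | yes v<y | no u≮x  =
      nested xy uv (uv≢xy ∘ sym) u≮x (Fin.<-asym v<y) p∈xy p∈uv

    embedding : PlanarEmbedding G
    embedding = record
      { pos           = pos
      ; bends         = λ _ _ → []
      ; pos-injective = abscissa-injective ∘ cong proj₁
      ; arc-simple    = λ (u<v , _) eq → ℚ.<⇒≢ (abscissa-mono-< u<v) (cong proj₁ eq)
      ; arc-vertex    = λ uv w w∈uv →
          Sum.map abscissa-injective abscissa-injective
            (onParabola-onChord (arc⇒onChord uv w∈uv))
      ; arc-arc       = arc-arc
      }

    -- The outer face

    open PlanarEmbedding embedding using (Drawing)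

    drawing-above : ∀ p → Drawing p → proj₁ p * proj₁ p ℚ.≤ proj₂ p
    drawing-above p (inj₁ (w , refl))          = ℚ.≤-refl
    drawing-above p (inj₂ (u , v , uv , p∈uv)) = onChord⇒above (arc⇒onChord uv p∈uv)

    -- Going straight down stays below the parabola, whereas the drawing lies on or above it.
    below⇒outer : ∀ {x y} → y ℚ.< x * x → OuterFace embedding (x , y)
    below⇒outer {x} {y} y<x² B = (x , z) , ([] , ray-free) , inj₂ B<∣z∣
      where
      -- The minimum with `y` makes the segment descend; the other term makes `z` exceed `B` in
      -- absolute value.
      z = y ⊓ (- (∣ B ∣ + 1ℚ))

      ray-free : ∀ r → Segment (x , y) (x , z) r → ¬ Drawing r
      ray-free r r∈ r∈D with vertical-segment (ℚ.p⊓q≤p y _) r∈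
      ... | refl , r₂≤y = ℚ.<-irrefl refl
        (ℚ.≤-<-trans (ℚ.≤-trans (drawing-above r r∈D) r₂≤y) y<x²)

      B<∣z∣ : B ℚ.< ∣ z ∣
      B<∣z∣ = begin-strict
        B                       ≤⟨ p≤∣p∣ B ⟩
        ∣ B ∣                   <⟨ p<p+q ∣ B ∣ (from-yes (0ℚ ℚ.<? 1ℚ)) ⟩
        ∣ B ∣ + 1ℚ              ≡⟨ solve 1 (λ p → :- (:- p) := p) refl (∣ B ∣ + 1ℚ) ⟨
        - (- (∣ B ∣ + 1ℚ))      ≤⟨ ℚ.neg-antimono-≤ (ℚ.p⊓q≤q y _) ⟩
        - z                     ≤⟨ p≤∣p∣ (- z) ⟩
        ∣ - z ∣                 ≡⟨ ℚ.∣-p∣≡∣p∣ z ⟩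
        ∣ z ∣                   ∎
        where
        open ℚ.≤-Reasoning
        open +-*-Solver

    polyline-source : ∀ {a} cs {b} → Polyline a cs b a
    polyline-source []       = segment-source
    polyline-source (c ∷ cs) = inj₁ segment-source

    vertex∉outer : ∀ v → ¬ OuterFace embedding (pos v)
    -- Any bound would do: a path that leaves the vertex contains the vertex, which belongs to the
    -- drawing.
    vertex∉outer v outer with outer 0ℚ
    ... | q , (cs , free) , _ = free (pos v) (polyline-source cs) (inj₁ (v , refl))

    -- The nearby point of the outer face lies straight below the vertex at a distance `δ` strictly
    -- between `0ℚ` and `ε`; the nearby point outside that face is the vertex itself.
    boundary : ∀ v → Boundary (OuterFace embedding) (pos v)
    boundary v ε 0<ε = (q , (near₀ x , near₁) , below⇒outer q₂<x²)
                     , (pos v , (near₀ x , near₀ (x * x)) , vertex∉outer v)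
      where
      x = abscissa v
      δ = proj₁ (ℚ.<-dense 0<ε)
      0<δ = proj₁ (proj₂ (ℚ.<-dense 0<ε))
      δ<ε = proj₂ (proj₂ (ℚ.<-dense 0<ε))
      q = x , x * x - δ

      near₀ : ∀ p → ∣ p - p ∣ ℚ.< ε
      near₀ p = subst (λ d → ∣ d ∣ ℚ.< ε) (sym (ℚ.+-inverseʳ p)) 0<ε

      near₁ : ∣ x * x - (x * x - δ) ∣ ℚ.< ε
      near₁ = subst (ℚ._< ε) (sym (trans (cong ∣_∣
        (solve 2 (λ y δ → y :- (y :- δ) := δ) refl (x * x) δ))
        (ℚ.0≤p⇒∣p∣≡p (ℚ.<⇒≤ 0<δ)))) δ<ε
        where open +-*-Solver

      q₂<x² : x * x - δ ℚ.< x * x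
      q₂<x² = subst (x * x - δ ℚ.<_) (ℚ.+-identityʳ (x * x))
        (ℚ.+-monoʳ-< (x * x) (ℚ.neg-antimono-< 0<δ))

  noncrossing⇒outerplanar : Outerplanar G
  noncrossing⇒outerplanar = embedding , boundary

-- The graph

module _ {n : ℕ} (E : List (Fin n × Fin n)) (increasing : All (λ (u , v) → u <ᶠ v) E) where

  private
    open DecMembership (≡-dec (Fin._≟_ {n}) (Fin._≟_ {n})) using (_∈?_)

    Adj : Fin n → Fin n → Set
    Adj u v = (u , v) ∈ E ⊎ (v , u) ∈ E

    adjacent-<⇒∈ : ∀ {u v} → u <ᶠ v → Adj u v → (u , v) ∈ E
    adjacent-<⇒∈ u<v (inj₁ uv∈E) = uv∈E
    adjacent-<⇒∈ u<v (inj₂ vu∈E) = contradiction u<v (Fin.<-asym (All.lookup increasing vu∈E))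

  graph : Graph
  graph = record
    { order  = n
    ; Adj    = Adj
    ; adj?   = λ u v → ((u , v) ∈? E) ⊎-dec ((v , u) ∈? E)
    ; symm   = Sum.swap
    ; irrefl = λ { refl → Sum.[ Fin.<-irrefl refl ∘ All.lookup increasing
                              , Fin.<-irrefl refl ∘ All.lookup increasing ] }
    }

  -- Phrased over the edge list, so that a concrete graph is settled by a finite decision.
  graph-outerplanar : All (λ (u , v) → All (λ (x , y) → ¬ (u <ᶠ x × x <ᶠ v × v <ᶠ y)) E) E →
                      Outerplanar graph
  graph-outerplanar nc = noncrossing⇒outerplanar graph λ uv xy u<x x<v v<y →
    All.lookup (All.lookup nc (adjacent-<⇒∈ (Fin.<-trans u<x x<v) uv))
      (adjacent-<⇒∈ (Fin.<-trans x<v v<y) xy) (u<x , x<v , v<y)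

-- The `zip` pairs consecutive vertices and thus gives the rim.
fanEdges : ∀ {n} → Fin n → List (Fin n) → List (Fin n × Fin n)
fanEdges v ws = map (v ,_) ws ++ zip ws (drop 1 ws)

-- The numbering follows the outer boundary: the rim of the fan at x₃ or x₄ comes
-- right after its apex, so that no two edges cross.
v x₁ x₂ x₃ p₁ p₂ p₃ p₄ x₄ q₁ q₂ q₃ q₄ x₅ x₆ : Fin 15
v  = # 0
x₁ = # 1
x₂ = # 2
x₃ = # 3
p₁ = # 4
p₂ = # 5
p₃ = # 6
p₄ = # 7
x₄ = # 8
q₁ = # 9
q₂ = # 10
q₃ = # 11
q₄ = # 12
x₅ = # 13
x₆ = # 14

xs ps qs : List (Fin 15)
xs = x₁ ∷ x₂ ∷ x₃ ∷ x₄ ∷ x₅ ∷ x₆ ∷ []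
ps = p₁ ∷ p₂ ∷ p₃ ∷ p₄ ∷ []
qs = q₁ ∷ q₂ ∷ q₃ ∷ q₄ ∷ []

edges : List (Fin 15 × Fin 15)
edges = fanEdges v xs ++ fanEdges x₃ ps ++ fanEdges x₄ qs

edges-increasing : All (λ (u , w) → u <ᶠ w) edges
edges-increasing = from-yes (all? (λ (u , w) → u Fin.<? w) edges)

G : Graph
G = graph edges edges-increasing

G-outerplanar : Outerplanar G
G-outerplanar = graph-outerplanar edges edges-increasing
  (from-yes (all? (λ (u , w) → all? (λ (x , y) →
    ¬? ((u Fin.<? x) ×-dec (x Fin.<? w) ×-dec (w Fin.<? y))) edges) edges))

-- Four colours do not suffice

module _ {C : Set} (_≟_ : DecidableEquality C) {c : Vertex G → C}
         (nonrep : NonRepetitiveColouring G c) (few : coloursUsed _≟_ c ≤ 4) where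
  open Graph G using (IsPath; adj?)

  private
    fan₃ : Fan G x₃ ps
    fan₃ = from-yes (fan? G x₃ ps)

    fan₄ : Fan G x₄ qs
    fan₄ = from-yes (fan? G x₄ qs)

    through : ∀ x y z ws → Dec (All (λ w → IsPath (w ∷ x ∷ y ∷ z ∷ [])) ws)
    through x y z = all? λ w → path? G (w ∷ x ∷ y ∷ z ∷ [])

    -- Each of the two fans is used in both directions along `xs`, which yields all four
    -- inequalities; running backwards accounts for `sym`.
    x₁≢x₃ : c x₁ ≢ c x₃
    x₁≢x₃ = fan-apex-≢ G nonrep _≟_ few fan₃ (from-yes (adj? x₃ x₂))
      (from-yes (through x₃ x₂ x₁ ps)) ∘ sym

    x₂≢x₄ : c x₂ ≢ c x₄
    x₂≢x₄ = fan-apex-≢ G nonrep _≟_ few fan₄ (from-yes (adj? x₄ x₃))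
      (from-yes (through x₄ x₃ x₂ qs)) ∘ sym

    x₃≢x₅ : c x₃ ≢ c x₅
    x₃≢x₅ = fan-apex-≢ G nonrep _≟_ few fan₃ (from-yes (adj? x₃ x₄))
      (from-yes (through x₃ x₄ x₅ ps))

    x₄≢x₆ : c x₄ ≢ c x₆
    x₄≢x₆ = fan-apex-≢ G nonrep _≟_ few fan₄ (from-yes (adj? x₄ x₅))
      (from-yes (through x₄ x₅ x₆ qs))

    period : ∀ {x y z w} → Fan G v (x ∷ y ∷ z ∷ w ∷ []) → c x ≢ c z → c y ≢ c w → c x ≡ c w
    period = period-3 G nonrep _≟_ few

  not-4-colourable : ⊥
  not-4-colourable = no-square G nonrep (x₁ ∷ x₂ ∷ x₃ ∷ []) (λ ())
    (from-yes (path? G xs))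
    -- Any four consecutive vertices of `xs` are the rim of a smaller fan at `v`.
    (cong₂ _∷_ (period (from-yes (fan? G v (x₁ ∷ x₂ ∷ x₃ ∷ x₄ ∷ []))) x₁≢x₃ x₂≢x₄)
    (cong₂ _∷_ (period (from-yes (fan? G v (x₂ ∷ x₃ ∷ x₄ ∷ x₅ ∷ []))) x₂≢x₄ x₃≢x₅)
    (cong₂ _∷_ (period (from-yes (fan? G v (x₃ ∷ x₄ ∷ x₅ ∷ x₆ ∷ []))) x₃≢x₅ x₄≢x₆)
    refl)))

theorem2 : ∃[ G ] (Outerplanar G ×
    (∀ {C : Set} (_≟_ : DecidableEquality C) (c : Vertex G → C) →
    NonRepetitiveColouring G c → 5 ≤ coloursUsed _≟_ c))
theorem2 = G , G-outerplanar , λ _≟_ c nonrep →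
  ℕ.≰⇒> (not-4-colourable _≟_ nonrep)
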